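{- Let $(D,\vec{s})$ be a data distribution derived from a $2\text{ - }(v,k,1)$ design with $k\ge 2$, and suppose the data set is partitioned into $v$ data groups (one for each symbol of the design) each containing the same number of data items. Then the ATAC computation can be effectively load balanced: there is an assignment of every unordered pair of distinct data items to a machine holding both items such that the numbers of pairs assigned to any two machines differ by at most $1$.
   Context: A $2\text{ - }(v,k,1)$ design (balanced incomplete block design with $\lambda=1$) is a set of $v$ symbols together with $m$ blocks such that each block contains exactly $k$ symbols, each symbol appears in exactly $r$ blocks, and each pair of distinct symbols appears together in exactly $1$ block. The data distribution derived from it is $(D,\vec{s})$, where $D$ is the $m\times v$ zero-one incidence matrix (rows indexed by blocks, columns by symbols, entry $1$ iff the block contains the symbol) and $\vec{s}=(\tfrac1v,\dots,\tfrac1v)^T\in\mathbb{R}^v$. Blocks are interpreted as machines and symbols as data groups: the data items are partitioned into $v$ data groups, data group $j$ containing the fraction $s_j=\tfrac1v$ of all items, and machine $i$ holds all items of every data group $j$ with $D_{ij}=1$ (and no others). An ATAC (All-to-All Comparison) computation requires that every unordered pair of distinct data items (in the same or in different data groups) be compared exactly once, on a machine that holds both items. All machines are equally capable and every comparison takes the same time, so the load of a machine is the number of comparisons assigned to it. A schedule is effectively load balanced if no machine is assigned more than $1$ comparison more than any other machine. -}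

module Defs where

open import Data.Bool.Base using (if_then_else_)
open import Data.Fin.Base using (Fin; _<_)
open import Data.Fin.Patterns using (0F; 1F)
open import Data.Fin.Properties using (_≟_; _<?_)
open import Data.Fin.Subset using (Subset; _∈_; ∣_∣)
open import Data.Fin.Subset.Properties using (_∈?_)
open import Data.Integer.Base using (+_)
open import Data.List.Base using (List; length; filter; allFin; cartesianProduct)
open import Data.Nat.Base using (ℕ; suc; _≤_; NonZero)
open import Data.Product.Base using (_×_; _,_; proj₂; Σ-syntax)
open import Data.Rational.Base using (ℚ; _/_; _*_)
open import Data.Vec.Functional using (Vector)
open import Level using (Level)
open import Relation.Binary.PropositionalEquality using (_≡_; _≢_)
open import Relation.Nullary.Decidable using (yes; no; does; map′; _×-dec_)
open import Relation.Unary using (Pred; Decidable)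

private
  variable
    ℓ : Level
    A : Set ℓ

count : {P : Pred A ℓ} → Decidable P → List A → ℕ
count P? xs = length (filter P? xs)

-- A 2-(v,k,1) design on the symbols Fin v.  Nonemptiness is required because
-- for v = 1, m = r = 0 the remaining fields hold for every k, while no machine
-- would be available to compare the items of the only data group.
record Design (v k : ℕ) : Set where
  field
    m r          : ℕ
    {{v-nonZero}} : NonZero v
    {{m-nonZero}} : NonZero m
    block        : Fin m → Subset v
    block-size   : ∀ i → ∣ block i ∣ ≡ k
    replication  : ∀ j → count (λ i → j ∈? block i) (allFin m) ≡ r
    pair-once    : ∀ {j j′} → j ≢ j′ →
                   count (λ i → (j ∈? block i) ×-dec (j′ ∈? block i)) (allFin m) ≡ 1

record DataDistribution (m v : ℕ) : Set where
  field
    D : Vector (Vector (Fin 2) v) m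
    s : Vector ℚ v

derived : ∀ {v k} (𝓑 : Design v k) → DataDistribution (Design.m 𝓑) v
derived {v} 𝓑 = record
  { D = λ i j → if does (j ∈? block i) then 1F else 0F
  ; s = λ _ → + 1 / v
  }
  where open Design 𝓑

module _ {m v : ℕ} (Δ : DataDistribution m v) where
  open DataDistribution Δ

  -- A partition of N data items into v data groups, group j containing the
  -- fraction s j of all items.
  record Partition (N : ℕ) : Set where
    field
      group : Fin N → Fin v

    groupSize : Fin v → ℕ
    groupSize j = count (λ x → group x ≟ j) (allFin N)

    field
      fraction : ∀ j → + groupSize j / 1 ≡ s j * (+ N / 1)

  module _ {N : ℕ} (𝒫 : Partition N) where
    open Partition 𝒫

    SameSizeGroups : Set
    SameSizeGroups = ∀ j j′ → groupSize j ≡ groupSize j′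

    Holds : Fin m → Fin N → Set
    Holds i x = D i (group x) ≡ 1F

    -- An unordered pair of distinct items is represented by its unique
    -- ordering x < y.
    record Schedule : Set where
      field
        machine  : ∀ {x y} → .(x < y) → Fin m
        feasible : ∀ {x y} (x<y : x < y) →
                   Holds (machine x<y) x × Holds (machine x<y) y

      AssignedTo : Fin m → Pred (Fin N × Fin N) _
      AssignedTo i (x , y) = Σ[ x<y ∈ x < y ] machine x<y ≡ i

      assignedTo? : ∀ i → Decidable (AssignedTo i)
      assignedTo? i (x , y) with x <? y
      ... | yes x<y = map′ (x<y ,_) proj₂ (machine x<y ≟ i)
      ... | no  x≮y = no λ (x<y , _) → x≮y x<y

      load : Fin m → ℕ
      load i = count (assignedTo? i) (cartesianProduct (allFin N) (allFin N))

    EffectivelyLoadBalanced : Schedule → Set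
    EffectivelyLoadBalanced σ = ∀ i i′ → load i ≤ suc (load i′)
      where open Schedule σ

{-# OPTIONS --safe #-}
-- Splitting every comparison equally among the machines able to perform it
-- gives all machines the same fractional load: the design is biregular and the
-- groups are equal.  It remains to round this fractional schedule.  Start from
-- any integral schedule and let R be the set of machines reachable from the
-- most loaded ones, of load L, by moving comparisons from machine to machine.
-- If R contains a machine of load at most L - 2, moving one unit of load to it
-- lowers the sum of the squared loads.  Otherwise the loads in R are L - 1 or L
-- and those outside are at most L - 1; as R receives at most its fractional
-- load and its complement at least its own, the complement is empty.
module Submission where

open import Data.Bool.Base using (true; false; if_then_else_)
open import Data.Fin.Base using (Fin; zero; suc; _<_)
open import Data.Fin.Patterns using (1F)
open import Data.Fin.Properties using (_≟_; _<?_; <-cmp; any?)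
open import Data.Fin.Subset using (Subset; inside; outside; ∣_∣)
open import Data.Fin.Subset.Properties using (_∈?_)
open import Data.List.Base
  using (List; []; _∷_; _++_; map; filter; allFin; cartesianProduct; tabulate)
open import Data.List.Extrema.Nat using (argmax; f[xs]≤f[argmax])
open import Data.List.Membership.Propositional using (_∈_; _∉_; find; lose)
open import Data.List.Membership.Propositional.Properties using (∈-allFin; ∈-filter⁺; ∈-filter⁻)
import Data.List.Membership.DecPropositional as DecMembership
open import Data.List.Properties using (map-∘; map-++; map-tabulate)
open import Data.List.Relation.Unary.All as All using (All; []; _∷_)
open import Data.List.Relation.Unary.AllPairs using (_∷_)
open import Data.List.Relation.Unary.Any as Any using (here; there)
open import Data.List.Relation.Unary.Unique.Propositional using (Unique)
import Data.List.Relation.Unary.Unique.Propositional.Properties as Unique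
open import Data.Nat.Base as ℕ using (ℕ; zero; suc; _+_; _*_; _≤_; _≥_; z≤n; s≤s; z<s)
import Data.Nat.Properties as ℕ
open import Data.Nat.Induction using (Acc; acc; <-wellFounded)
open import Data.Nat.ListAction using (sum)
open import Data.Nat.ListAction.Properties using (sum-++)
open import Data.Nat.Tactic.RingSolver using (solve-∀)
open import Data.Product.Base using (_×_; _,_; proj₁; proj₂; ∃-syntax; Σ-syntax)
open import Data.Product.Properties using (≡-dec)
open import Data.Sum.Base using (_⊎_; inj₁; inj₂; [_,_])
import Data.Vec.Base as Vec
open import Function.Base using (_∘_; id)
open import Level using (Level)
open import Relation.Binary.Definitions using (DecidableEquality; tri<; tri≈; tri>)
open import Relation.Binary.PropositionalEquality hiding ([_])
open import Relation.Nullary using (¬_; Dec; yes; no; does; contradiction; ¬?)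
open import Relation.Nullary.Decidable using (_×-dec_; dec-true; dec-false)
open import Relation.Unary using (Pred; Decidable)

open import Defs

private
  variable
    a p q : Level
    A B : Set a

-- Indicators and finite sums

𝟙 : {P : Set p} → Dec P → ℕ
𝟙 P? = if does P? then 1 else 0

𝟙-yes : {P : Set p} (P? : Dec P) → P → 𝟙 P? ≡ 1
𝟙-yes P? x rewrite dec-true P? x = refl

𝟙-no : {P : Set p} (P? : Dec P) → ¬ P → 𝟙 P? ≡ 0
𝟙-no P? ¬x rewrite dec-false P? ¬x = refl

𝟙-mono : {P : Set p} {Q : Set q} (P? : Dec P) (Q? : Dec Q) → (P → Q) → 𝟙 P? ≤ 𝟙 Q?
𝟙-mono (yes x) Q? f = ℕ.≤-reflexive (sym (𝟙-yes Q? (f x)))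
𝟙-mono (no _)  Q? f = z≤n

𝟙-× : {P : Set p} {Q : Set q} (P? : Dec P) (Q? : Dec Q) → 𝟙 (P? ×-dec Q?) ≡ 𝟙 P? * 𝟙 Q?
𝟙-× (yes _) (yes _) = refl
𝟙-× (yes _) (no _)  = refl
𝟙-× (no _)  _       = refl

𝟙-idem : {P : Set p} (P? : Dec P) → 𝟙 P? * 𝟙 P? ≡ 𝟙 P?
𝟙-idem (yes _) = refl
𝟙-idem (no _)  = refl

∑ : List A → (A → ℕ) → ℕ
∑ xs f = sum (map f xs)

syntax ∑ xs (λ x → e) = ∑[ x ← xs ] e

*-pos⁻ : ∀ m {n} → 0 ℕ.< m * n → 0 ℕ.< m × 0 ℕ.< n
*-pos⁻ (suc m) {suc n} _ = z<s , z<s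
*-pos⁻ (suc m) {zero} pos rewrite ℕ.*-zeroʳ m = contradiction pos λ ()

∑-mono-∈ : ∀ (xs : List A) {f g : A → ℕ} → (∀ {x} → x ∈ xs → f x ≤ g x) → ∑ xs f ≤ ∑ xs g
∑-mono-∈ []       f≤g = z≤n
∑-mono-∈ (x ∷ xs) f≤g = ℕ.+-mono-≤ (f≤g (here refl)) (∑-mono-∈ xs (f≤g ∘ there))

∑-mono : ∀ (xs : List A) {f g : A → ℕ} → (∀ x → f x ≤ g x) → ∑ xs f ≤ ∑ xs g
∑-mono xs f≤g = ∑-mono-∈ xs (λ {x} _ → f≤g x)

∑-mono-< : ∀ {xs : List A} {f g : A → ℕ} {x} → x ∈ xs → (∀ y → f y ≤ g y) → f x ℕ.< g x →
           ∑ xs f ℕ.< ∑ xs g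
∑-mono-< {xs = _ ∷ xs} (here refl) f≤g fx<gx = ℕ.+-mono-<-≤ fx<gx (∑-mono xs f≤g)
∑-mono-< {xs = y ∷ _}  (there x∈)  f≤g fx<gx = ℕ.+-mono-≤-< (f≤g y) (∑-mono-< x∈ f≤g fx<gx)

∑-cong : ∀ (xs : List A) {f g : A → ℕ} → (∀ x → f x ≡ g x) → ∑ xs f ≡ ∑ xs g
∑-cong []       f≡g = refl
∑-cong (x ∷ xs) f≡g = cong₂ _+_ (f≡g x) (∑-cong xs f≡g)

∑-zero : (xs : List A) → ∑[ x ← xs ] 0 ≡ 0
∑-zero []       = refl
∑-zero (_ ∷ xs) = ∑-zero xs

∑-pos⁻ : ∀ (xs : List A) {f : A → ℕ} → 0 ℕ.< ∑ xs f → ∃[ x ] 0 ℕ.< f x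
∑-pos⁻ (x ∷ xs) {f} pos with f x in eq
... | zero  = ∑-pos⁻ xs pos
... | suc _ = x , subst (0 ℕ.<_) (sym eq) z<s

+-interchange : ∀ k l m n → (k + l) + (m + n) ≡ (k + m) + (l + n)
+-interchange = solve-∀

∑-distrib-+ : ∀ (xs : List A) (f g : A → ℕ) → ∑[ x ← xs ] (f x + g x) ≡ ∑ xs f + ∑ xs g
∑-distrib-+ []       f g = refl
∑-distrib-+ (x ∷ xs) f g rewrite ∑-distrib-+ xs f g = +-interchange (f x) (g x) (∑ xs f) (∑ xs g)

*-distribˡ-∑ : ∀ (xs : List A) c (f : A → ℕ) → c * ∑ xs f ≡ ∑[ x ← xs ] (c * f x)
*-distribˡ-∑ []       c f = ℕ.*-zeroʳ c
*-distribˡ-∑ (x ∷ xs) c f =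
  trans (ℕ.*-distribˡ-+ c (f x) (∑ xs f)) (cong (c * f x +_) (*-distribˡ-∑ xs c f))

*-distribʳ-∑ : ∀ (xs : List A) c (f : A → ℕ) → ∑ xs f * c ≡ ∑[ x ← xs ] (f x * c)
*-distribʳ-∑ xs c f =
  trans (ℕ.*-comm _ c) (trans (*-distribˡ-∑ xs c f) (∑-cong xs (λ x → ℕ.*-comm c (f x))))

∑-swap : ∀ (xs : List A) (ys : List B) (f : A → B → ℕ) →
         ∑[ x ← xs ] ∑[ y ← ys ] f x y ≡ ∑[ y ← ys ] ∑[ x ← xs ] f x y
∑-swap []       ys f = sym (∑-zero ys)
∑-swap (x ∷ xs) ys f = trans (cong (∑ ys (f x) +_) (∑-swap xs ys f))
                             (sym (∑-distrib-+ ys (f x) (λ y → ∑[ x ← xs ] f x y)))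

∑-filter : ∀ {P : Pred A p} (P? : Decidable P) xs (f : A → ℕ) →
           ∑ (filter P? xs) f ≡ ∑[ x ← xs ] (𝟙 (P? x) * f x)
∑-filter P? []       f = refl
∑-filter P? (x ∷ xs) f with does (P? x)
... | true  = cong₂ _+_ (sym (ℕ.+-identityʳ (f x))) (∑-filter P? xs f)
... | false = ∑-filter P? xs f

count≡∑ : ∀ {P : Pred A p} (P? : Decidable P) xs → count P? xs ≡ ∑[ x ← xs ] 𝟙 (P? x)
count≡∑ P? []       = refl
count≡∑ P? (x ∷ xs) with does (P? x)
... | true  = cong suc (count≡∑ P? xs)
... | false = count≡∑ P? xs

∑-++ : ∀ (xs ys : List A) (f : A → ℕ) → ∑ (xs ++ ys) f ≡ ∑ xs f + ∑ ys f
∑-++ xs ys f = trans (cong sum (map-++ f xs ys)) (sum-++ (map f xs) (map f ys))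

∑-cartesianProduct : ∀ (xs : List A) (ys : List B) (f : A × B → ℕ) →
                     ∑ (cartesianProduct xs ys) f ≡ ∑[ x ← xs ] ∑[ y ← ys ] f (x , y)
∑-cartesianProduct []       ys f = refl
∑-cartesianProduct (x ∷ xs) ys f =
  trans (∑-++ (map (x ,_) ys) _ f)
        (cong₂ _+_ (cong sum (sym (map-∘ ys))) (∑-cartesianProduct xs ys f))

-- Uniqueness makes `x` occur only once in `xs`, so the indicator selects a single summand.
∑-δ : ∀ (_≟′_ : DecidableEquality A) {xs x} → Unique xs → x ∈ xs → ∀ (f : _ → ℕ) →
      ∑[ y ← xs ] (𝟙 (x ≟′ y) * f y) ≡ f x
∑-δ _≟′_ {x ∷ xs} (x∉ ∷ _) (here refl) f = begin
  𝟙 (x ≟′ x) * f x + ∑[ y ← xs ] (𝟙 (x ≟′ y) * f y)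
    ≡⟨ cong₂ _+_ (cong (_* f x) (𝟙-yes (x ≟′ x) refl)) (vanish xs x∉) ⟩
  1 * f x + 0 ≡⟨ ℕ.+-identityʳ _ ⟩
  1 * f x     ≡⟨ ℕ.*-identityˡ _ ⟩
  f x         ∎
  where
  open ≡-Reasoning
  vanish : ∀ ys → All (x ≢_) ys → ∑[ y ← ys ] (𝟙 (x ≟′ y) * f y) ≡ 0
  vanish []       []         = refl
  vanish (y ∷ ys) (x≢y ∷ x≢) =
    cong₂ _+_ (cong (_* f y) (𝟙-no (x ≟′ y) x≢y)) (vanish ys x≢)
∑-δ _≟′_ {z ∷ xs} {x} (z∉ ∷ xs!) (there x∈) f = begin
  𝟙 (x ≟′ z) * f z + ∑[ y ← xs ] (𝟙 (x ≟′ y) * f y)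
    ≡⟨ cong (λ d → d * f z + _) (𝟙-no (x ≟′ z) λ x≡z → All.lookup z∉ x∈ (sym x≡z)) ⟩
  ∑[ y ← xs ] (𝟙 (x ≟′ y) * f y)
    ≡⟨ ∑-δ _≟′_ xs! x∈ f ⟩
  f x ∎
  where open ≡-Reasoning

∑-allFin-δ : ∀ {n} (i : Fin n) (f : Fin n → ℕ) → ∑[ j ← allFin n ] (𝟙 (i ≟ j) * f j) ≡ f i
∑-allFin-δ {n} i f = ∑-δ _≟_ (Unique.allFin⁺ n) (∈-allFin i) f

-- Balanced assignments from fractional ones

-- Job `a` gives machine `i` the fraction `w a i` / `c` of itself; clearing denominators keeps
-- everything in ℕ. The support of `w a` is also the set of machines allowed to run `a`.
module Balancing
  {A : Set} (_≟ᴬ_ : DecidableEquality A) {m : ℕ}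
  {jobs : List A} (jobs! : Unique jobs)
  (w : A → Fin m → ℕ) (c W : ℕ) (c>0 : 0 ℕ.< c)
  (∑ᵢw : ∀ a → ∑ (allFin m) (w a) ≡ c)
  (∑ₐw : ∀ i → ∑[ a ← jobs ] w a i ≡ W)
  where

  open DecMembership (_≟_ {m}) using () renaming (_∈?_ to _∈ᴸ?_)

  machines : List (Fin m)
  machines = allFin m

  Assignment : Set
  Assignment = A → Fin m

  Feasible : Assignment → Set
  Feasible σ = ∀ a → 0 ℕ.< w a (σ a)

  load : Assignment → Fin m → ℕ
  load σ i = ∑[ a ← jobs ] 𝟙 (σ a ≟ i)

  potential : Assignment → ℕ
  potential σ = ∑[ i ← machines ] (load σ i * load σ i)

  -- Each job contributes `χ (σ a) * c`, and `c` is spread out again as the sum of `w a`. This puts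
  -- the integral load in the same double-sum form as the fractional load in `weighted-total`, so
  -- the two can be compared term by term.
  weighted-load : ∀ σ (χ : Fin m → ℕ) →
    ∑[ i ← machines ] (χ i * (c * load σ i)) ≡
    ∑[ a ← jobs ] ∑[ i ← machines ] (χ (σ a) * w a i)
  weighted-load σ χ = begin
    ∑[ i ← machines ] (χ i * (c * load σ i))
      ≡⟨ ∑-cong machines (λ i → trans (sym (ℕ.*-assoc (χ i) c _)) (*-distribˡ-∑ jobs (χ i * c) _)) ⟩
    ∑[ i ← machines ] ∑[ a ← jobs ] (χ i * c * 𝟙 (σ a ≟ i))
      ≡⟨ ∑-swap machines jobs _ ⟩
    ∑[ a ← jobs ] ∑[ i ← machines ] (χ i * c * 𝟙 (σ a ≟ i))
      ≡⟨ ∑-cong jobs (λ a → trans (∑-cong machines (λ i → ℕ.*-comm (χ i * c) _))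
                                  (∑-allFin-δ (σ a) (λ i → χ i * c))) ⟩
    ∑[ a ← jobs ] (χ (σ a) * c)
      ≡⟨ ∑-cong jobs (λ a → trans (cong (χ (σ a) *_) (sym (∑ᵢw a)))
                                  (*-distribˡ-∑ machines (χ (σ a)) (w a))) ⟩
    ∑[ a ← jobs ] ∑[ i ← machines ] (χ (σ a) * w a i) ∎
    where open ≡-Reasoning

  weighted-total : ∀ (χ : Fin m → ℕ) →
    ∑[ a ← jobs ] ∑[ i ← machines ] (χ i * w a i) ≡ ∑[ i ← machines ] (χ i * W)
  weighted-total χ = begin
    ∑[ a ← jobs ] ∑[ i ← machines ] (χ i * w a i)
      ≡⟨ ∑-swap jobs machines _ ⟩
    ∑[ i ← machines ] ∑[ a ← jobs ] (χ i * w a i)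
      ≡⟨ ∑-cong machines (λ i → trans (sym (*-distribˡ-∑ jobs (χ i) _)) (cong (χ i *_) (∑ₐw i))) ⟩
    ∑[ i ← machines ] (χ i * W) ∎
    where open ≡-Reasoning

  reassign : Assignment → A → Fin m → Assignment
  reassign σ a y b = if does (a ≟ᴬ b) then y else σ b

  reassign-≢ : ∀ σ {a b} y → a ≢ b → reassign σ a y b ≡ σ b
  reassign-≢ σ {a} {b} y a≢b rewrite dec-false (a ≟ᴬ b) a≢b = refl

  reassign-feasible : ∀ {σ a y} → Feasible σ → 0 ℕ.< w a y → Feasible (reassign σ a y)
  reassign-feasible {a = a} σ-feasible way>0 b with a ≟ᴬ b
  ... | yes refl = way>0
  ... | no  _    = σ-feasible b

  -- The departure is added on the left instead of subtracted on the right, which avoids truncated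
  -- subtraction and also covers `y` equal to `σ a`.
  load-reassign : ∀ σ {a} y → a ∈ jobs → ∀ i →
    load (reassign σ a y) i + 𝟙 (σ a ≟ i) ≡ load σ i + 𝟙 (y ≟ i)
  load-reassign σ {a} y a∈ i = begin
    load (reassign σ a y) i + 𝟙 (σ a ≟ i)
      ≡⟨ cong (load (reassign σ a y) i +_) (sym (∑-δ _≟ᴬ_ jobs! a∈ _)) ⟩
    load (reassign σ a y) i + ∑[ b ← jobs ] (𝟙 (a ≟ᴬ b) * 𝟙 (σ b ≟ i))
      ≡⟨ sym (∑-distrib-+ jobs _ _) ⟩
    ∑[ b ← jobs ] (𝟙 (reassign σ a y b ≟ i) + 𝟙 (a ≟ᴬ b) * 𝟙 (σ b ≟ i))
      ≡⟨ ∑-cong jobs pointwise ⟩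
    ∑[ b ← jobs ] (𝟙 (σ b ≟ i) + 𝟙 (a ≟ᴬ b) * 𝟙 (y ≟ i))
      ≡⟨ ∑-distrib-+ jobs _ _ ⟩
    load σ i + ∑[ b ← jobs ] (𝟙 (a ≟ᴬ b) * 𝟙 (y ≟ i))
      ≡⟨ cong (load σ i +_) (∑-δ _≟ᴬ_ jobs! a∈ _) ⟩
    load σ i + 𝟙 (y ≟ i) ∎
    where
    open ≡-Reasoning
    pointwise : ∀ b → 𝟙 (reassign σ a y b ≟ i) + 𝟙 (a ≟ᴬ b) * 𝟙 (σ b ≟ i) ≡
                      𝟙 (σ b ≟ i) + 𝟙 (a ≟ᴬ b) * 𝟙 (y ≟ i)
    pointwise b with does (a ≟ᴬ b)
    ... | false = refl
    ... | true  = lem (𝟙 (y ≟ i)) (𝟙 (σ b ≟ i))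
      where
      lem : ∀ k l → k + (l + 0) ≡ l + (k + 0)
      lem = solve-∀

  -- Moving a unit from `s` to `x` changes the sum of squares by 2(load x + 1) - 2(load s), which is
  -- negative by the gap.
  potential-< : ∀ {σ σ′ s x} →
    (∀ i → load σ′ i + 𝟙 (s ≟ i) ≡ load σ i + 𝟙 (x ≟ i)) →
    suc (load σ x) ℕ.< load σ s → potential σ′ ℕ.< potential σ
  potential-< {σ} {σ′} {s} {x} shift gap = ℕ.+-cancelʳ-< (2 * load σ s) _ _ (begin-strict
    potential σ′ + 2 * load σ s
      ≡⟨ cong (potential σ′ +_) (trans (cong (2 *_) (sym (∑-allFin-δ s (load σ))))
                                          (*-distribˡ-∑ machines 2 _)) ⟩
    potential σ′ + ∑[ i ← machines ] (2 * (𝟙 (s ≟ i) * load σ i))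
      ≡⟨ ∑-distrib-+ machines _ _ ⟨
    ∑[ i ← machines ] (load σ′ i * load σ′ i + 2 * (𝟙 (s ≟ i) * load σ i))
      ≤⟨ ∑-mono machines pointwise ⟩
    ∑[ i ← machines ] (load σ i * load σ i + (𝟙 (x ≟ i) * (2 * load σ i + 1) + 𝟙 (s ≟ i) * 1))
      ≡⟨ ∑-distrib-+ machines _ _ ⟩
    potential σ + ∑[ i ← machines ] (𝟙 (x ≟ i) * (2 * load σ i + 1) + 𝟙 (s ≟ i) * 1)
      ≡⟨ cong (potential σ +_) (∑-distrib-+ machines _ _) ⟩
    potential σ + (∑[ i ← machines ] (𝟙 (x ≟ i) * (2 * load σ i + 1)) +
                   ∑[ i ← machines ] (𝟙 (s ≟ i) * 1))
      ≡⟨ cong (potential σ +_) (cong₂ _+_ (∑-allFin-δ x _) (∑-allFin-δ s _)) ⟩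
    potential σ + (2 * load σ x + 1 + 1)
      ≡⟨ cong (potential σ +_) (lem (load σ x)) ⟩
    potential σ + 2 * suc (load σ x)
      <⟨ ℕ.+-monoʳ-< (potential σ) (ℕ.*-monoʳ-< 2 gap) ⟩
    potential σ + 2 * load σ s ∎)
    where
    open ℕ.≤-Reasoning
    lem : ∀ k → 2 * k + 1 + 1 ≡ 2 * suc k
    lem = solve-∀
    -- `ds` and `dx` are the indicators of source and target at one machine. Both sides agree unless
    -- both indicators are 1, where there is a slack of 2; hence only an inequality.
    square : ∀ l l′ (ds dx : ℕ) → ds ≤ 1 → dx ≤ 1 → l′ + ds ≡ l + dx →
             l′ * l′ + 2 * (ds * l) ≤ l * l + (dx * (2 * l + 1) + ds * 1)
    square l l′ zero zero _ _ eq
      rewrite trans (sym (ℕ.+-identityʳ l′)) (trans eq (ℕ.+-identityʳ l)) = ℕ.≤-refl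
    square l l′ zero (suc zero) _ _ eq
      rewrite trans (sym (ℕ.+-identityʳ l′)) eq = ℕ.≤-reflexive (expand l)
      where
      expand : ∀ l → (l + 1) * (l + 1) + 0 ≡ l * l + (2 * l + 1 + 0 + 0)
      expand = solve-∀
    square l l′ (suc zero) zero _ _ eq
      rewrite sym (trans eq (ℕ.+-identityʳ l)) = ℕ.≤-reflexive (expand l′)
      where
      expand : ∀ l → l * l + 2 * (1 * (l + 1)) ≡ (l + 1) * (l + 1) + (0 + 1)
      expand = solve-∀
    square l l′ (suc zero) (suc zero) _ _ eq
      rewrite ℕ.+-cancelʳ-≡ 1 l′ l eq = ℕ.+-monoʳ-≤ (l * l)
        (subst (2 * (1 * l) ≤_) (expand l) (ℕ.m≤m+n (2 * (1 * l)) 2))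
      where
      expand : ∀ l → 2 * (1 * l) + 2 ≡ 1 * (2 * l + 1) + 1 * 1
      expand = solve-∀
    square l l′ (suc (suc _)) _ (s≤s ()) _ _
    square l l′ _ (suc (suc _)) _ (s≤s ()) _
    𝟙≤1 : ∀ {P : Set} (P? : Dec P) → 𝟙 P? ≤ 1
    𝟙≤1 (yes _) = ℕ.≤-refl
    𝟙≤1 (no _)  = z≤n
    pointwise : ∀ i → load σ′ i * load σ′ i + 2 * (𝟙 (s ≟ i) * load σ i) ≤
                load σ i * load σ i + (𝟙 (x ≟ i) * (2 * load σ i + 1) + 𝟙 (s ≟ i) * 1)
    pointwise i = square (load σ i) (load σ′ i) _ _ (𝟙≤1 (s ≟ i)) (𝟙≤1 (x ≟ i)) (shift i)

  -- The fractional assignment w / c gives every machine the load W / c.  A set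
  -- R closed under moving jobs has average load at most W / c, and its complement
  -- at least W / c, so whichever way W compares with c * ℓ one of them is violated.
  closed⇒full : ∀ σ ℓ (R : List (Fin m)) →
    (∀ {a y} → a ∈ jobs → σ a ∈ R → 0 ℕ.< w a y → y ∈ R) →
    (∀ {x} → x ∈ R → ℓ ≤ load σ x) →
    (∀ {x} → x ∉ R → load σ x ≤ ℓ) →
    ∀ {s} → s ∈ R → ℓ ℕ.< load σ s → ∀ x → x ∈ R
  closed⇒full σ ℓ R closed R≥ℓ ∁R≤ℓ {s} s∈R ℓ<s x with x ∈ᴸ? R
  ... | yes x∈R = x∈R
  ... | no  x∉R with ℕ.≤-<-connex W (c * ℓ)
  ...   | inj₁ W≤cℓ = contradiction R-load≤ (ℕ.<⇒≱ R-load>)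
    where
    χ : Fin m → ℕ
    χ i = 𝟙 (i ∈ᴸ? R)
    R-load≤ : ∑[ i ← machines ] (χ i * (c * load σ i)) ≤ ∑[ i ← machines ] (χ i * W)
    R-load≤ = subst₂ _≤_ (sym (weighted-load σ χ)) (weighted-total χ)
      (∑-mono-∈ jobs λ {a} a∈ → ∑-mono machines (pointwise a∈))
      where
      -- Closedness: if `σ a` is in `R`, so is every machine of positive weight for `a`. Summed over
      -- the jobs, the load of `R` is at most its fractional load.
      pointwise : ∀ {a} → a ∈ jobs → ∀ i → χ (σ a) * w a i ≤ χ i * w a i
      pointwise {a} a∈ i with σ a ∈ᴸ? R | w a i in eq
      ... | no _    | _     = z≤n
      ... | yes _   | zero  = z≤n
      ... | yes σa∈ | suc k
        rewrite 𝟙-yes (i ∈ᴸ? R) (closed a∈ σa∈ (subst (0 ℕ.<_) (sym eq) z<s)) = ℕ.≤-refl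
    -- `W ≤ c * ℓ` may be an equality, so strictness comes from `s`, whose load exceeds `ℓ`.
    R-load> : ∑[ i ← machines ] (χ i * W) ℕ.< ∑[ i ← machines ] (χ i * (c * load σ i))
    R-load> = ∑-mono-< (∈-allFin s) pointwise strict
      where
      pointwise : ∀ i → χ i * W ≤ χ i * (c * load σ i)
      pointwise i with i ∈ᴸ? R
      ... | yes i∈ = ℕ.*-monoʳ-≤ 1 (ℕ.≤-trans W≤cℓ (ℕ.*-monoʳ-≤ c (R≥ℓ i∈)))
      ... | no  _  = z≤n
      strict : χ s * W ℕ.< χ s * (c * load σ s)
      strict rewrite 𝟙-yes (s ∈ᴸ? R) s∈R =
        ℕ.*-monoʳ-< 1 (ℕ.≤-<-trans W≤cℓ (ℕ.*-monoʳ-< c {{ℕ.>-nonZero c>0}} ℓ<s))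
  ...   | inj₂ cℓ<W = contradiction ∁R-load≥ (ℕ.<⇒≱ ∁R-load<)
    where
    χ : Fin m → ℕ
    χ i = 𝟙 (¬? (i ∈ᴸ? R))
    ∁R-load≥ : ∑[ i ← machines ] (χ i * W) ≤ ∑[ i ← machines ] (χ i * (c * load σ i))
    ∁R-load≥ = subst₂ _≤_ (weighted-total χ) (sym (weighted-load σ χ))
      (∑-mono-∈ jobs λ {a} a∈ → ∑-mono machines (pointwise a∈))
      where
      -- Contrapositive of closedness: a machine outside `R` with positive weight for `a` forces
      -- `σ a` outside `R`.
      pointwise : ∀ {a} → a ∈ jobs → ∀ i → χ i * w a i ≤ χ (σ a) * w a i
      pointwise {a} a∈ i with σ a ∈ᴸ? R | w a i in eq
      ... | yes _   | zero  = ℕ.≤-reflexive (ℕ.*-zeroʳ (χ i))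
      ... | yes σa∈ | suc k
        rewrite 𝟙-no (¬? (i ∈ᴸ? R)) (λ i∉ → i∉ (closed a∈ σa∈ (subst (0 ℕ.<_) (sym eq) z<s))) = z≤n
      ... | no _    | k with does (i ∈ᴸ? R)
      ...   | true  = z≤n
      ...   | false = ℕ.≤-refl
    -- Here the inequality is strict at every machine outside `R`, and `x` is one of them.
    ∁R-load< : ∑[ i ← machines ] (χ i * (c * load σ i)) ℕ.< ∑[ i ← machines ] (χ i * W)
    ∁R-load< = ∑-mono-< (∈-allFin x) pointwise strict
      where
      below : ∀ {i} → i ∉ R → c * load σ i ℕ.< W
      below i∉ = ℕ.≤-<-trans (ℕ.*-monoʳ-≤ c (∁R≤ℓ i∉)) cℓ<W
      pointwise : ∀ i → χ i * (c * load σ i) ≤ χ i * W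
      pointwise i with i ∈ᴸ? R
      ... | yes _  = z≤n
      ... | no  i∉ = ℕ.*-monoʳ-≤ 1 (ℕ.<⇒≤ (below i∉))
      strict : χ x * (c * load σ x) ℕ.< χ x * W
      strict rewrite 𝟙-yes (¬? (x ∈ᴸ? R)) x∉R = ℕ.*-monoʳ-< 1 (below x∉R)

  -- Moving load along paths of machines

  Improvement : Assignment → Set
  Improvement σ = ∃[ σ′ ] Feasible σ′ × potential σ′ ℕ.< potential σ

  module _ (σ : Assignment) (σ-feasible : Feasible σ) (ℓ : ℕ)
           (load≤ : ∀ i → load σ i ≤ suc ℓ) where

    -- A unit of load has travelled from a machine s of maximal load to x along
    -- a path in R; the last field makes any job of x available for a next move.
    record Moved (R : List (Fin m)) (x : Fin m) : Set where
      field
        σ′       : Assignment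
        feasible : Feasible σ′
        s        : Fin m
        s-load   : load σ s ≡ suc ℓ
        shift    : ∀ i → load σ′ i + 𝟙 (s ≟ i) ≡ load σ i + 𝟙 (x ≟ i)
        agrees   : ∀ {b} → σ b ≡ x ⊎ σ b ∉ R → σ′ b ≡ σ b

    Moved-weaken : ∀ {R x y} → Moved R x → Moved (y ∷ R) x
    Moved-weaken μ = record
      { Moved μ
      ; agrees = [ Moved.agrees μ ∘ inj₁ , (λ σb∉ → Moved.agrees μ (inj₂ (σb∉ ∘ there))) ]
      }

    -- Job `a` still sits on `σ a` after the earlier moves, so it can be passed on to `y`; the
    -- arrival at `σ a` and the new departure cancel. Jobs of machines outside `R` are untouched, in
    -- particular those of the new endpoint `y`.
    Moved-step : ∀ {R a y} → a ∈ jobs → σ a ∈ R → y ∉ R → 0 ℕ.< w a y →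
                 Moved R (σ a) → Moved (y ∷ R) y
    Moved-step {R} {a} {y} a∈ σa∈R y∉R way>0 μ = record
      { σ′       = reassign σ′ a y
      ; feasible = reassign-feasible feasible way>0
      ; s        = s
      ; s-load   = s-load
      ; shift    = shift′
      ; agrees   = [ (λ σb≡y → keeps (λ σb∈R → y∉R (subst (_∈ R) σb≡y σb∈R)))
                   , (λ σb∉ → keeps (σb∉ ∘ there)) ]
      }
      where
      open Moved μ
      keeps : ∀ {b} → σ b ∉ R → reassign σ′ a y b ≡ σ b
      keeps {b} σb∉R = trans
        (reassign-≢ σ′ y (λ a≡b → σb∉R (subst (λ b → σ b ∈ R) a≡b σa∈R)))
        (agrees (inj₂ σb∉R))
      shift′ : ∀ i → load (reassign σ′ a y) i + 𝟙 (s ≟ i) ≡ load σ i + 𝟙 (y ≟ i)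
      shift′ i = ℕ.+-cancelʳ-≡ δx _ _ (begin
        load (reassign σ′ a y) i + 𝟙 (s ≟ i) + δx
          ≡⟨ +-swapʳ (load (reassign σ′ a y) i) (𝟙 (s ≟ i)) δx ⟩
        load (reassign σ′ a y) i + δx + 𝟙 (s ≟ i)
          ≡⟨ cong (_+ 𝟙 (s ≟ i)) (subst (λ x → load (reassign σ′ a y) i + 𝟙 (x ≟ i) ≡ _)
                                        (agrees (inj₁ refl)) (load-reassign σ′ y a∈ i)) ⟩
        load σ′ i + 𝟙 (y ≟ i) + 𝟙 (s ≟ i)         ≡⟨ +-swapʳ (load σ′ i) (𝟙 (y ≟ i)) (𝟙 (s ≟ i)) ⟩
        load σ′ i + 𝟙 (s ≟ i) + 𝟙 (y ≟ i)         ≡⟨ cong (_+ 𝟙 (y ≟ i)) (shift i) ⟩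
        load σ i + δx + 𝟙 (y ≟ i)                 ≡⟨ +-swapʳ (load σ i) δx (𝟙 (y ≟ i)) ⟩
        load σ i + 𝟙 (y ≟ i) + δx                 ∎)
        where
        open ≡-Reasoning
        δx = 𝟙 (σ a ≟ i)
        +-swapʳ : ∀ k l n → k + l + n ≡ k + n + l
        +-swapʳ = solve-∀

    Moved-improve : ∀ {R x} → load σ x ℕ.< ℓ → Moved R x → Improvement σ
    Moved-improve {x = x} x<ℓ μ =
      σ′ , feasible ,
      potential-< {σ} {σ′} {s} {x} shift (subst (suc (load σ x) ℕ.<_) (sym s-load) (s≤s x<ℓ))
      where open Moved μ

    -- Termination measure of `search`, in which every recursive call adds a new machine to `R`.
    outside-size : List (Fin m) → ℕ
    outside-size R = ∑[ i ← machines ] 𝟙 (¬? (i ∈ᴸ? R))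

    outside-size-∷ : ∀ {R y} → y ∉ R → outside-size (y ∷ R) ℕ.< outside-size R
    outside-size-∷ {R} {y} y∉R = ∑-mono-< (∈-allFin y)
      (λ i → 𝟙-mono (¬? (i ∈ᴸ? (y ∷ R))) (¬? (i ∈ᴸ? R)) (_∘ there)) strict
      where
      strict : 𝟙 (¬? (y ∈ᴸ? (y ∷ R))) ℕ.< 𝟙 (¬? (y ∈ᴸ? R))
      strict rewrite 𝟙-yes (¬? (y ∈ᴸ? R)) y∉R
                   | 𝟙-no (¬? (y ∈ᴸ? (y ∷ R))) (λ y∉ → y∉ (here refl)) = z<s

    -- Grows the set `R` of reachable machines. An exit to a machine of load below `ℓ` yields an
    -- improvement; an exit to any other machine enlarges `R` and keeps the load bounds. Without
    -- exits `R` is closed, so by `closed⇒full` it contains all machines.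
    search : ∀ R → Acc ℕ._<_ (outside-size R) →
             (∀ {x} → x ∈ R → Moved R x) → (∀ {x} → x ∈ R → ℓ ≤ load σ x) →
             (∀ {x} → x ∉ R → load σ x ≤ ℓ) → ∀ {s} → s ∈ R → ℓ ℕ.< load σ s →
             (∀ i → ℓ ≤ load σ i) ⊎ Improvement σ
    search R (acc rec) moved R≥ℓ ∁R≤ℓ s∈R ℓ<s
      with Any.any? (λ a → (σ a ∈ᴸ? R) ×-dec any? (λ y → (0 ℕ.<? w a y) ×-dec ¬? (y ∈ᴸ? R))) jobs
    ... | no ¬exit = inj₁ λ i → R≥ℓ (closed⇒full σ ℓ R closed R≥ℓ ∁R≤ℓ s∈R ℓ<s i)
      where
      closed : ∀ {a y} → a ∈ jobs → σ a ∈ R → 0 ℕ.< w a y → y ∈ R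
      closed {y = y} a∈ σa∈ way>0 with y ∈ᴸ? R
      ... | yes y∈ = y∈
      ... | no  y∉ = contradiction (lose a∈ (σa∈ , y , way>0 , y∉)) ¬exit
    ... | yes exit with find exit
    ...   | a , a∈ , σa∈ , y , way>0 , y∉ with ℕ.<-≤-connex (load σ y) ℓ
    ...     | inj₁ y<ℓ = inj₂ (Moved-improve y<ℓ (Moved-step a∈ σa∈ y∉ way>0 (moved σa∈)))
    ...     | inj₂ ℓ≤y = search (y ∷ R) (rec (outside-size-∷ y∉))
      (λ { (here refl) → Moved-step a∈ σa∈ y∉ way>0 (moved σa∈)
         ; (there x∈)  → Moved-weaken (moved x∈) })
      (λ { (here refl) → ℓ≤y ; (there x∈) → R≥ℓ x∈ })
      (λ x∉ → ∁R≤ℓ (x∉ ∘ there)) (there s∈R) ℓ<s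

    -- Taking all machines of load `suc ℓ` as the initial set leaves only loads at most `ℓ` outside,
    -- as `search` requires.
    balance-step : ∀ {s} → load σ s ≡ suc ℓ → (∀ i → ℓ ≤ load σ i) ⊎ Improvement σ
    balance-step {s} s-load = search R₀ (<-wellFounded _)
      -- The empty path: `x` is both source and endpoint, and nothing has moved.
      (λ {x} x∈ → record
        { σ′ = σ ; feasible = σ-feasible ; s = x ; s-load = R₀-load x∈
        ; shift = λ _ → refl ; agrees = λ _ → refl })
      (λ x∈ → subst (ℓ ≤_) (sym (R₀-load x∈)) (ℕ.n≤1+n ℓ))
      (λ {x} x∉ → ℕ.≤-pred (ℕ.≤∧≢⇒< (load≤ x) (λ eq → x∉ (∈-filter⁺ maximal? (∈-allFin x) eq))))
      (∈-filter⁺ maximal? (∈-allFin s) s-load)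
      (ℕ.≤-reflexive (sym s-load))
      where
      maximal? : Decidable (λ x → load σ x ≡ suc ℓ)
      maximal? x = load σ x ℕ.≟ suc ℓ
      R₀ : List (Fin m)
      R₀ = filter maximal? machines
      R₀-load : ∀ {x} → x ∈ R₀ → load σ x ≡ suc ℓ
      R₀-load x∈ = proj₂ (∈-filter⁻ maximal? {xs = machines} x∈)

  -- Descent on the sum of squared loads

  Balanced : Assignment → Set
  Balanced σ = ∀ i i′ → load σ i ≤ suc (load σ i′)

  heaviest : Fin m → ∀ σ → ∃[ s ] (∀ i → load σ i ≤ load σ s)
  heaviest i₀ σ = argmax (load σ) i₀ machines ,
    λ i → All.lookup (f[xs]≤f[argmax] i₀ machines) (∈-allFin i)

  balance : Fin m → ∀ σ → Feasible σ → Acc ℕ._<_ (potential σ) → ∃[ σ ] Feasible σ × Balanced σ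
  balance i₀ σ σ-feasible (acc rec) with heaviest i₀ σ
  ... | s , ≤s with load σ s in s-load
  -- If the maximal load is 0, all loads are equal; otherwise it has the form `suc ℓ` that
  -- `balance-step` expects.
  ...   | zero  = σ , σ-feasible , λ i _ → ℕ.≤-trans (≤s i) z≤n
  ...   | suc ℓ with balance-step σ σ-feasible ℓ ≤s s-load
  ...     | inj₁ ℓ≤load = σ , σ-feasible , λ i i′ → ℕ.≤-trans (≤s i) (s≤s (ℓ≤load i′))
  ...     | inj₂ (σ′ , σ′-feasible , smaller) = balance i₀ σ′ σ′-feasible (rec smaller)

  balanced-assignment : Fin m → ∃[ σ ] Feasible σ × Balanced σ
  balanced-assignment i₀ = balance i₀ (proj₁ ∘ support) (proj₂ ∘ support) (<-wellFounded _)
    where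
    -- The initial assignment: the weights of a job sum to `c > 0`, so some machine is allowed to
    -- run it.
    support : ∀ a → ∃[ i ] 0 ℕ.< w a i
    support a = ∑-pos⁻ machines (subst (0 ℕ.<_) (sym (∑ᵢw a)) c>0)

-- Unordered pairs of items

-- Trichotomy splits the square into the diagonal and two triangles, which have equal sums by
-- symmetry of `f`.
∑-ordered-pairs : ∀ N (f : Fin N → Fin N → ℕ) → (∀ x y → f x y ≡ f y x) →
  ∑[ x ← allFin N ] ∑[ y ← allFin N ] f x y ≡
  2 * ∑[ x ← allFin N ] ∑[ y ← allFin N ] (𝟙 (x <? y) * f x y) + ∑[ x ← allFin N ] f x x
∑-ordered-pairs N f f-sym = begin
  ∑[ x ← xs ] ∑[ y ← xs ] f x y
    ≡⟨ ∑-cong xs (λ x → ∑-cong xs (split x)) ⟩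
  ∑[ x ← xs ] ∑[ y ← xs ] (below x y + below y x + 𝟙 (x ≟ y) * f x y)
    ≡⟨ ∑-cong xs (λ x → trans (∑-distrib-+ xs _ _)
         (cong₂ _+_ (∑-distrib-+ xs (below x) (λ y → below y x)) (∑-allFin-δ x (f x)))) ⟩
  ∑[ x ← xs ] (∑ xs (below x) + ∑[ y ← xs ] below y x + f x x)
    ≡⟨ trans (∑-distrib-+ xs _ _) (cong (_+ ∑[ x ← xs ] f x x) (∑-distrib-+ xs _ _)) ⟩
  S + ∑[ x ← xs ] ∑[ y ← xs ] below y x + ∑[ x ← xs ] f x x
    ≡⟨ cong (λ T → S + T + ∑[ x ← xs ] f x x) (trans (∑-swap xs xs _) (sym (ℕ.+-identityʳ S))) ⟩
  2 * S + ∑[ x ← xs ] f x x ∎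
  where
  open ≡-Reasoning
  xs = allFin N
  below : Fin N → Fin N → ℕ
  below x y = 𝟙 (x <? y) * f x y
  S = ∑[ x ← xs ] ∑ xs (below x)
  split : ∀ x y → f x y ≡ below x y + below y x + 𝟙 (x ≟ y) * f x y
  split x y with <-cmp x y
  ... | tri< x<y x≢y y≮x rewrite 𝟙-yes (x <? y) x<y | 𝟙-no (y <? x) y≮x | 𝟙-no (x ≟ y) x≢y =
    lem (f x y)
    where
    lem : ∀ k → k ≡ k + 0 + 0 + 0
    lem = solve-∀
  ... | tri≈ x≮y x≡y y≮x rewrite 𝟙-no (x <? y) x≮y | 𝟙-no (y <? x) y≮x | 𝟙-yes (x ≟ y) x≡y =
    sym (ℕ.+-identityʳ (f x y))
  ... | tri> x≮y x≢y y<x rewrite 𝟙-no (x <? y) x≮y | 𝟙-yes (y <? x) y<x | 𝟙-no (x ≟ y) x≢y =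
    trans (f-sym x y) (lem (f y x))
    where
    lem : ∀ k → k ≡ k + 0 + 0
    lem = solve-∀

pairs : ∀ N → List (Fin N × Fin N)
pairs N = filter (λ (x , y) → x <? y) (cartesianProduct (allFin N) (allFin N))

pairs-unique : ∀ N → Unique (pairs N)
pairs-unique N = Unique.filter⁺ _ (Unique.cartesianProduct⁺ (Unique.allFin⁺ N) (Unique.allFin⁺ N))

∑-pairs : ∀ N (f : Fin N → Fin N → ℕ) →
  ∑[ p ← pairs N ] f (proj₁ p) (proj₂ p) ≡
  ∑[ x ← allFin N ] ∑[ y ← allFin N ] (𝟙 (x <? y) * f x y)
∑-pairs N f = trans (∑-filter (λ (x , y) → x <? y) (cartesianProduct (allFin N) (allFin N)) _)
                    (∑-cartesianProduct (allFin N) (allFin N) _)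

-- Grouping the items by their image under `h` makes every value `f j` occur `g` times.
∑-fibres : ∀ {N v g} (h : Fin N → Fin v) → (∀ j → count (λ x → h x ≟ j) (allFin N) ≡ g) →
           ∀ (f : Fin v → ℕ) → ∑[ x ← allFin N ] f (h x) ≡ g * ∑ (allFin v) f
∑-fibres {N} {v} {g} h fibre f = begin
  ∑[ x ← allFin N ] f (h x)
    ≡⟨ ∑-cong (allFin N) (λ x → sym (∑-allFin-δ (h x) f)) ⟩
  ∑[ x ← allFin N ] ∑[ j ← allFin v ] (𝟙 (h x ≟ j) * f j)
    ≡⟨ ∑-swap (allFin N) (allFin v) _ ⟩
  ∑[ j ← allFin v ] ∑[ x ← allFin N ] (𝟙 (h x ≟ j) * f j)
    ≡⟨ ∑-cong (allFin v) (λ j → trans (sym (*-distribʳ-∑ (allFin N) (f j) _))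
         (cong (_* f j) (trans (sym (count≡∑ (λ x → h x ≟ j) (allFin N))) (fibre j)))) ⟩
  ∑[ j ← allFin v ] (g * f j)
    ≡⟨ sym (*-distribˡ-∑ (allFin v) g f) ⟩
  g * ∑ (allFin v) f ∎
  where open ≡-Reasoning

∑-∈? : ∀ {n} (p : Subset n) → ∑[ j ← allFin n ] 𝟙 (j ∈? p) ≡ ∣ p ∣
∑-∈? Vec.[] = refl
∑-∈? {suc n} (s Vec.∷ p) = trans (cong (𝟙 (zero ∈? (s Vec.∷ p)) +_) rest) (head s)
  where
  rest : sum (map (λ j → 𝟙 (j ∈? (s Vec.∷ p))) (tabulate suc)) ≡ ∣ p ∣
  rest = trans (cong sum (trans (map-tabulate Fin.suc (λ j → 𝟙 (j ∈? (s Vec.∷ p))))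
                                (sym (map-tabulate id (λ j → 𝟙 (j ∈? p))))))
               (∑-∈? p)
  head : ∀ s → 𝟙 (zero ∈? (s Vec.∷ p)) + ∣ p ∣ ≡ ∣ s Vec.∷ p ∣
  head inside  = refl
  head outside = refl

-- The fractional schedule of a design

module _ {v k : ℕ} (𝓑 : Design v k) where
  open Design 𝓑

  mem : Fin m → Fin v → ℕ
  mem i j = 𝟙 (j ∈? block i)

  ∑-mem : ∀ i → ∑ (allFin v) (mem i) ≡ k
  ∑-mem i = trans (∑-∈? (block i)) (block-size i)

  -- Block `i` contains some symbol `j`, and `i` itself is then counted in the replication number of
  -- `j`.
  r>0 : k ≥ 2 → Fin m → 0 ℕ.< r
  r>0 k≥2 i with ∑-pos⁻ (allFin v) (subst (0 ℕ.<_) (sym (∑-mem i)) (ℕ.≤-trans z<s k≥2))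
  ... | j , mem>0 = subst (0 ℕ.<_) (trans (sym (count≡∑ _ (allFin m))) (replication j))
    (subst (ℕ._< ∑[ i ← allFin m ] mem i j) (∑-zero (allFin m))
      (∑-mono-< (∈-allFin i) (λ _ → z≤n) mem>0))

  multiplicity : Fin v → Fin v → ℕ
  multiplicity j j′ = if does (j ≟ j′) then 1 else r

  -- A comparison within a group is shared equally by the r machines holding
  -- that group; one between groups goes entirely to the only possible machine.
  -- Weights are in units of 1 / r.
  share : Fin m → Fin v → Fin v → ℕ
  share i j j′ = mem i j * mem i j′ * multiplicity j j′

  share-sym : ∀ i j j′ → share i j j′ ≡ share i j′ j
  share-sym i j j′ = cong₂ _*_ (ℕ.*-comm (mem i j) _) (mult-sym (j ≟ j′))
    where
    mult-sym : Dec (j ≡ j′) → multiplicity j j′ ≡ multiplicity j′ j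
    mult-sym (yes refl) = refl
    mult-sym (no j≢j′) rewrite dec-false (j ≟ j′) j≢j′ | dec-false (j′ ≟ j) (j≢j′ ∘ sym) = refl

  share-diagonal : ∀ i j → share i j j ≡ mem i j
  share-diagonal i j rewrite dec-true (j ≟ j) refl =
    trans (ℕ.*-identityʳ _) (𝟙-idem (j ∈? block i))

  -- Within a group, replication gives `r` holders of weight 1; between two groups, `pair-once`
  -- gives one holder of weight `r`. So `r` is the common denominator `c` of the fractional
  -- schedule.
  ∑-share-machines : ∀ j j′ → ∑[ i ← allFin m ] share i j j′ ≡ r
  ∑-share-machines j j′ with j ≟ j′
  ... | yes refl = begin
    ∑[ i ← allFin m ] (mem i j * mem i j * 1)
      ≡⟨ ∑-cong (allFin m) (λ i → trans (ℕ.*-identityʳ _) (𝟙-idem (j ∈? block i))) ⟩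
    ∑[ i ← allFin m ] mem i j
      ≡⟨ sym (count≡∑ (λ i → j ∈? block i) (allFin m)) ⟩
    count (λ i → j ∈? block i) (allFin m)
      ≡⟨ replication j ⟩
    r ∎
    where open ≡-Reasoning
  ... | no j≢j′ = begin
    ∑[ i ← allFin m ] (mem i j * mem i j′ * r)
      ≡⟨ sym (*-distribʳ-∑ (allFin m) r _) ⟩
    ∑[ i ← allFin m ] (mem i j * mem i j′) * r
      ≡⟨ cong (_* r) (∑-cong (allFin m) (λ i → sym (𝟙-× (j ∈? block i) (j′ ∈? block i)))) ⟩
    ∑[ i ← allFin m ] 𝟙 ((j ∈? block i) ×-dec (j′ ∈? block i)) * r
      ≡⟨ cong (_* r) (trans
           (sym (count≡∑ (λ i → (j ∈? block i) ×-dec (j′ ∈? block i)) (allFin m)))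
           (pair-once j≢j′)) ⟩
    1 * r ≡⟨ ℕ.*-identityˡ r ⟩
    r     ∎
    where open ≡-Reasoning

  -- A block has `k` diagonal pairs of weight 1 and k(k - 1) ordered off-diagonal pairs of weight
  -- `r`. Adding `k * r` to both sides avoids subtraction.
  ∑-share-symbols : ∀ i → ∑[ j ← allFin v ] ∑[ j′ ← allFin v ] share i j j′ + k * r ≡ k * k * r + k
  ∑-share-symbols i = begin
    ∑[ j ← vs ] ∑[ j′ ← vs ] share i j j′ + k * r
      ≡⟨ cong (∑[ j ← vs ] ∑[ j′ ← vs ] share i j j′ +_)
           (trans (cong (_* r) (sym (∑-mem i))) (*-distribʳ-∑ vs r (mem i))) ⟩
    ∑[ j ← vs ] ∑[ j′ ← vs ] share i j j′ + ∑[ j ← vs ] (mem i j * r)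
      ≡⟨ sym (∑-distrib-+ vs _ _) ⟩
    ∑[ j ← vs ] (∑[ j′ ← vs ] share i j j′ + mem i j * r)
      ≡⟨ ∑-cong vs row ⟩
    ∑[ j ← vs ] (mem i j * (k * r) + mem i j)
      ≡⟨ ∑-distrib-+ vs _ _ ⟩
    ∑[ j ← vs ] (mem i j * (k * r)) + ∑ vs (mem i)
      ≡⟨ cong (_+ ∑ vs (mem i)) (sym (*-distribʳ-∑ vs (k * r) (mem i))) ⟩
    ∑ vs (mem i) * (k * r) + ∑ vs (mem i)
      ≡⟨ cong (λ s → s * (k * r) + s) (∑-mem i) ⟩
    k * (k * r) + k
      ≡⟨ cong (_+ k) (sym (ℕ.*-assoc k k r)) ⟩
    k * k * r + k ∎
    where
    open ≡-Reasoning
    vs = allFin v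
    -- `b` stands for a 0-1 indicator, of which only idempotence is used.
    diagonal : ∀ b → b * b ≡ b → b * b * 1 + 1 * (b * r) ≡ b * r * b + 1 * b
    diagonal b b²≡b = begin
      b * b * 1 + 1 * (b * r) ≡⟨ cong (λ n → n * 1 + 1 * (b * r)) b²≡b ⟩
      b * 1 + 1 * (b * r)     ≡⟨ lem₁ b r ⟩
      b * r + 1 * b           ≡⟨ cong (λ n → n * r + 1 * b) b²≡b ⟨
      b * b * r + 1 * b       ≡⟨ cong (_+ 1 * b) (lem₂ b r) ⟩
      b * r * b + 1 * b       ∎
      where
      lem₁ : ∀ b r → b * 1 + 1 * (b * r) ≡ b * r + 1 * b
      lem₁ = solve-∀
      lem₂ : ∀ b r → b * b * r ≡ b * r * b
      lem₂ = solve-∀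
    -- Trading the diagonal weight 1 for `r` turns the entry into a plain product, whose sum
    -- factors; the two indicator terms record the trade.
    entry : ∀ j j′ → share i j j′ + 𝟙 (j ≟ j′) * (mem i j′ * r) ≡
                     mem i j * r * mem i j′ + 𝟙 (j ≟ j′) * mem i j′
    entry j j′ with j ≟ j′
    ... | yes refl = diagonal (mem i j) (𝟙-idem (j ∈? block i))
    ... | no _ = lem (mem i j) (mem i j′) r
      where
      lem : ∀ b b′ r → b * b′ * r + 0 ≡ b * r * b′ + 0
      lem = solve-∀
    row : ∀ j → ∑[ j′ ← vs ] share i j j′ + mem i j * r ≡ mem i j * (k * r) + mem i j
    row j = begin
      ∑[ j′ ← vs ] share i j j′ + mem i j * r
        ≡⟨ cong (∑[ j′ ← vs ] share i j j′ +_) (sym (∑-allFin-δ j (λ j′ → mem i j′ * r))) ⟩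
      ∑[ j′ ← vs ] share i j j′ + ∑[ j′ ← vs ] (𝟙 (j ≟ j′) * (mem i j′ * r))
        ≡⟨ sym (∑-distrib-+ vs _ _) ⟩
      ∑[ j′ ← vs ] (share i j j′ + 𝟙 (j ≟ j′) * (mem i j′ * r))
        ≡⟨ ∑-cong vs (entry j) ⟩
      ∑[ j′ ← vs ] (mem i j * r * mem i j′ + 𝟙 (j ≟ j′) * mem i j′)
        ≡⟨ ∑-distrib-+ vs _ _ ⟩
      ∑[ j′ ← vs ] (mem i j * r * mem i j′) + ∑[ j′ ← vs ] (𝟙 (j ≟ j′) * mem i j′)
        ≡⟨ cong₂ _+_ (sym (*-distribˡ-∑ vs (mem i j * r) (mem i))) (∑-allFin-δ j (mem i)) ⟩
      mem i j * r * ∑ vs (mem i) + mem i j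
        ≡⟨ cong (_+ mem i j) (trans (cong (mem i j * r *_) (∑-mem i)) (lem (mem i j) r k)) ⟩
      mem i j * (k * r) + mem i j ∎
      where
      lem : ∀ b r k → b * r * k ≡ b * (k * r)
      lem = solve-∀

  share-pos⁻ : ∀ {i j j′} → 0 ℕ.< share i j j′ → 0 ℕ.< mem i j × 0 ℕ.< mem i j′
  share-pos⁻ {i} {j} {j′} pos = *-pos⁻ (mem i j) (proj₁ (*-pos⁻ (mem i j * mem i j′) pos))

  derived-D : ∀ {i j} → 0 ℕ.< mem i j → DataDistribution.D (derived 𝓑) i j ≡ 1F
  derived-D {i} {j} pos with does (j ∈? block i)
  ... | true = refl

-- The sum over all ordered pairs of items is `g * g` times the sum over symbols; it counts each
-- unordered pair twice, and the equal items contribute `g * k`. The right-hand side does not depend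
-- on `i`.
∑-share-pairs : ∀ {v k} (𝓑 : Design v k) {N g} (h : Fin N → Fin v) →
  (∀ j → count (λ x → h x ≟ j) (allFin N) ≡ g) → ∀ i →
  2 * ∑[ p ← pairs N ] share 𝓑 i (h (proj₁ p)) (h (proj₂ p)) + g * k + g * g * (k * Design.r 𝓑) ≡
  g * g * (k * k * Design.r 𝓑 + k)
∑-share-pairs {v} {k} 𝓑 {N} {g} h fibre i = begin
  2 * ∑[ p ← pairs N ] φ (h (proj₁ p)) (h (proj₂ p)) + g * k + g * g * (k * r)
    ≡⟨ cong (_+ g * g * (k * r)) (cong₂ (λ s t → 2 * s + t)
         (∑-pairs N (λ x y → φ (h x) (h y))) diagonal) ⟩
  2 * ∑[ x ← ns ] ∑[ y ← ns ] (𝟙 (x <? y) * φ (h x) (h y)) + ∑[ x ← ns ] φ (h x) (h x)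
      + g * g * (k * r)
    ≡⟨ cong (_+ g * g * (k * r)) (sym (∑-ordered-pairs N _ (λ x y → share-sym 𝓑 i (h x) (h y)))) ⟩
  ∑[ x ← ns ] ∑[ y ← ns ] φ (h x) (h y) + g * g * (k * r)
    ≡⟨ cong (_+ g * g * (k * r)) square ⟩
  g * g * ∑[ j ← vs ] ∑ vs (φ j) + g * g * (k * r)
    ≡⟨ sym (ℕ.*-distribˡ-+ (g * g) _ _) ⟩
  g * g * (∑[ j ← vs ] ∑ vs (φ j) + k * r)
    ≡⟨ cong (g * g *_) (∑-share-symbols 𝓑 i) ⟩
  g * g * (k * k * r + k) ∎
  where
  open ≡-Reasoning
  open Design 𝓑 using (r)
  ns = allFin N
  vs = allFin v
  φ : Fin v → Fin v → ℕ
  φ = share 𝓑 i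
  diagonal : g * k ≡ ∑[ x ← ns ] φ (h x) (h x)
  diagonal = sym (begin
    ∑[ x ← ns ] φ (h x) (h x) ≡⟨ ∑-cong ns (λ x → share-diagonal 𝓑 i (h x)) ⟩
    ∑[ x ← ns ] mem 𝓑 i (h x) ≡⟨ ∑-fibres h fibre (mem 𝓑 i) ⟩
    g * ∑ vs (mem 𝓑 i)        ≡⟨ cong (g *_) (∑-mem 𝓑 i) ⟩
    g * k                     ∎)
  square : ∑[ x ← ns ] ∑[ y ← ns ] φ (h x) (h y) ≡ g * g * ∑[ j ← vs ] ∑ vs (φ j)
  square = begin
    ∑[ x ← ns ] ∑[ y ← ns ] φ (h x) (h y)
      ≡⟨ ∑-cong ns (λ x → ∑-fibres h fibre (φ (h x))) ⟩
    ∑[ x ← ns ] (g * ∑ vs (φ (h x)))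
      ≡⟨ sym (*-distribˡ-∑ ns g _) ⟩
    g * ∑[ x ← ns ] ∑ vs (φ (h x))
      ≡⟨ cong (g *_) (∑-fibres h fibre (λ j → ∑ vs (φ j))) ⟩
    g * (g * ∑[ j ← vs ] ∑ vs (φ j))
      ≡⟨ sym (ℕ.*-assoc g g _) ⟩
    g * g * ∑[ j ← vs ] ∑ vs (φ j) ∎

share-total : ∀ {v k} (𝓑 : Design v k) {N} → (Fin N → Fin v) → Fin (Design.m 𝓑) → ℕ
share-total 𝓑 {N} h i = ∑[ p ← pairs N ] share 𝓑 i (h (proj₁ p)) (h (proj₂ p))

-- All machines have the same fractional load: `∑-share-pairs` gives both totals the same value once
-- the common terms and the factor 2 are cancelled.
share-total-const : ∀ {v k} (𝓑 : Design v k) {N g} (h : Fin N → Fin v) →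
  (∀ j → count (λ x → h x ≟ j) (allFin N) ≡ g) → ∀ i i′ → share-total 𝓑 h i ≡ share-total 𝓑 h i′
share-total-const {k = k} 𝓑 {g = g} h fibre i i′ =
  ℕ.*-cancelˡ-≡ (share-total 𝓑 h i) (share-total 𝓑 h i′) 2
    (ℕ.+-cancelʳ-≡ (g * k) (2 * share-total 𝓑 h i) (2 * share-total 𝓑 h i′)
      (ℕ.+-cancelʳ-≡ (g * g * (k * Design.r 𝓑))
        (2 * share-total 𝓑 h i + g * k) (2 * share-total 𝓑 h i′ + g * k)
        (trans (∑-share-pairs 𝓑 h fibre i) (sym (∑-share-pairs 𝓑 h fibre i′)))))

-- From fractional to actual schedules

someFin : ∀ n → .{{ℕ.NonZero n}} → Fin n
someFin (suc _) = zero

module _ {v k : ℕ} (𝓑 : Design v k) {N : ℕ} (𝒫 : Partition (derived 𝓑) N) where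
  open Design 𝓑
  open Partition 𝒫

  comparison-share : Fin N × Fin N → Fin m → ℕ
  comparison-share (x , y) i = share 𝓑 i (group x) (group y)

  -- A positive share has both membership indicators as factors, so the chosen machine holds both
  -- items. Since `σ` is defined on all pairs, the proof of `x < y` can be ignored.
  assignment⇒schedule : (σ : Fin N × Fin N → Fin m) → (∀ p → 0 ℕ.< comparison-share p (σ p)) →
                        Schedule (derived 𝓑) 𝒫
  assignment⇒schedule σ σ-feasible = record
    { machine  = λ {x} {y} _ → σ (x , y)
    ; feasible = λ {x} {y} _ →
        let i = σ (x , y)
            posˣ , posʸ = share-pos⁻ 𝓑 {i} {group x} {group y} (σ-feasible (x , y))
        in derived-D 𝓑 {i} {group x} posˣ , derived-D 𝓑 {i} {group y} posʸ
    }

  -- Identifies the load of the schedule with the load that `Balancing` controls.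
  load-assignment : ∀ σ σ-feasible i →
    Schedule.load (assignment⇒schedule σ σ-feasible) i ≡ ∑[ p ← pairs N ] 𝟙 (σ p ≟ i)
  load-assignment σ σ-feasible i = begin
    load i
      ≡⟨ count≡∑ (assignedTo? i) grid ⟩
    ∑[ p ← grid ] 𝟙 (assignedTo? i p)
      ≡⟨ ∑-cong grid pointwise ⟩
    ∑[ p ← grid ] (𝟙 (proj₁ p <? proj₂ p) * 𝟙 (σ p ≟ i))
      ≡⟨ ∑-filter (λ (x , y) → x <? y) grid (λ p → 𝟙 (σ p ≟ i)) ⟨
    ∑[ p ← pairs N ] 𝟙 (σ p ≟ i) ∎
    where
    open ≡-Reasoning
    open Schedule (assignment⇒schedule σ σ-feasible) using (load; assignedTo?)
    grid = cartesianProduct (allFin N) (allFin N)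
    pointwise : ∀ p → 𝟙 (assignedTo? i p) ≡ 𝟙 (proj₁ p <? proj₂ p) * 𝟙 (σ p ≟ i)
    pointwise (x , y) with x <? y
    ... | yes x<y = sym (trans (cong (_* 𝟙 (σ (x , y) ≟ i)) (𝟙-yes (x <? y) x<y)) (ℕ.*-identityˡ _))
    ... | no  x≮y = sym (cong (_* 𝟙 (σ (x , y) ≟ i)) (𝟙-no (x <? y) x≮y))

theorem14 : ∀ {v k : ℕ} (𝓑 : Design v k) → k ≥ 2 →
    ∀ {N : ℕ} (𝒫 : Partition (derived 𝓑) N) → SameSizeGroups (derived 𝓑) 𝒫 →
    Σ[ σ ∈ Schedule (derived 𝓑) 𝒫 ] EffectivelyLoadBalanced (derived 𝓑) 𝒫 σ
theorem14 {v} 𝓑 k≥2 {N} 𝒫 same = schedule balanced-assignment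
  where
  open Design 𝓑
  open Partition 𝒫
  i₀ : Fin m
  i₀ = someFin m

  -- The jobs are the pairs with `x < y` and the denominator is `r`. The common fractional load is
  -- read off at the machine `i₀`, and the common group size at an arbitrary symbol.
  open Balancing (≡-dec _≟_ _≟_) (pairs-unique N) (comparison-share 𝓑 𝒫) r
    (share-total 𝓑 group i₀) (r>0 𝓑 k≥2 i₀)
    (λ (x , y) → ∑-share-machines 𝓑 (group x) (group y))
    (λ i → share-total-const 𝓑 group (λ j → same j (someFin v)) i i₀)
    using (Feasible; Balanced; balanced-assignment)

  schedule : (Fin m → ∃[ σ ] Feasible σ × Balanced σ) →
             Σ[ σ ∈ Schedule (derived 𝓑) 𝒫 ] EffectivelyLoadBalanced (derived 𝓑) 𝒫 σ
  schedule assign with assign i₀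
  ... | σ , σ-feasible , σ-balanced = assignment⇒schedule 𝓑 𝒫 σ σ-feasible , λ i i′ →
    subst₂ (λ l l′ → l ≤ suc l′)
      (sym (load-assignment 𝓑 𝒫 σ σ-feasible i)) (sym (load-assignment 𝓑 𝒫 σ σ-feasible i′))
      (σ-balanced i i′)
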